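{- The rule ($\rho7$): from $(p\rightsquigarrow\phi)\wedge p\to\psi$ infer $\phi\to\psi$ (where $p$ is a propositional variable not occurring in $\phi,\psi$) is admissible in $\mathsf{MS^2IC}$: whenever $(p\rightsquigarrow\phi)\wedge p\to\psi$ is a theorem of $\mathsf{MS^2IC}$ with $p$ not occurring in $\phi,\psi$, so is $\phi\to\psi$.
   Context: Language: propositional variables, $\top,\bot$, $\neg,\wedge,\vee,\to,\leftrightarrow$, a binary connective $\rightsquigarrow$ and a unary modality $\Box$; $\Diamond\phi:=\neg\Box\neg\phi$, $[\forall]\phi:=\top\rightsquigarrow\phi$. $\mathsf{MS^2IC}$: theorems are the least set containing all instances of classical tautologies and of (A1) $(\bot\rightsquigarrow\phi)\wedge(\phi\rightsquigarrow\top)$; (A2) $((\phi\vee\psi)\rightsquigarrow\chi)\leftrightarrow((\phi\rightsquigarrow\chi)\wedge(\psi\rightsquigarrow\chi))$; (A3) $(\phi\rightsquigarrow(\psi\wedge\chi))\leftrightarrow((\phi\rightsquigarrow\psi)\wedge(\phi\rightsquigarrow\chi))$; (A4) $(\phi\rightsquigarrow\psi)\to(\phi\to\psi)$; (A5) $(\phi\rightsquigarrow\psi)\leftrightarrow(\neg\psi\rightsquigarrow\neg\phi)$; (A8) $[\forall]\phi\to[\forall][\forall]\phi$; (A9) $\neg[\forall]\phi\to[\forall]\neg[\forall]\phi$; (A10) $(\phi\rightsquigarrow\psi)\leftrightarrow[\forall](\phi\rightsquigarrow\psi)$; (A11) $[\forall]\phi\to(\neg[\forall]\phi\rightsquigarrow\bot)$;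 (K) $\Box(\phi\to\psi)\to(\Box\phi\to\Box\psi)$; (Add) $(\phi\rightsquigarrow\psi)\to(\Box\phi\rightsquigarrow\Box\psi)$; closed under modus ponens, from $\phi$ infer $[\forall]\phi$, from $\phi$ infer $\Box\phi$. -}

module Defs where

open import Data.Nat using (ℕ)
open import Data.Bool using (Bool; true; false; not; _∧_; _∨_; if_then_else_)
open import Relation.Binary.PropositionalEquality using (_≡_; _≢_)

infixr 20 _⇝_
infixr 15 _⇒_ _⇔_
infixr 16 _∨'_
infixr 17 _∧'_
data Fm : Set where
  var  : ℕ → Fm
  ⊤'   : Fm
  ⊥'   : Fm
  ¬'_  : Fm → Fm
  _∧'_ : Fm → Fm → Fm
  _∨'_ : Fm → Fm → Fm
  _⇒_  : Fm → Fm → Fm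
  _⇔_  : Fm → Fm → Fm
  _⇝_  : Fm → Fm → Fm
  □_   : Fm → Fm

[∀]_ : Fm → Fm
[∀] φ = ⊤' ⇝ φ

eval : (Fm → Bool) → Fm → Bool
eval V (var n)   = V (var n)
eval V ⊤'        = true
eval V ⊥'        = false
eval V (¬' φ)    = not (eval V φ)
eval V (φ ∧' ψ)  = eval V φ ∧ eval V ψ
eval V (φ ∨' ψ)  = eval V φ ∨ eval V ψ
eval V (φ ⇒ ψ)   = not (eval V φ) ∨ eval V ψ
eval V (φ ⇔ ψ)   = if eval V φ then eval V ψ else not (eval V ψ)
eval V (φ ⇝ ψ)   = V (φ ⇝ ψ)
eval V (□ φ)     = V (□ φ)

-- φ is an instance of a classical tautology: true under every Boolean assignment to its
-- maximal non-Boolean subformulas (variables, ⇝-formulas, □-formulas).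
Taut : Fm → Set
Taut φ = ∀ (V : Fm → Bool) → eval V φ ≡ true

data ⊢_ : Fm → Set where
  taut : ∀ {φ} → Taut φ → ⊢ φ
  A1   : ∀ φ → ⊢ ((⊥' ⇝ φ) ∧' (φ ⇝ ⊤'))
  A2   : ∀ φ ψ χ → ⊢ (((φ ∨' ψ) ⇝ χ) ⇔ ((φ ⇝ χ) ∧' (ψ ⇝ χ)))
  A3   : ∀ φ ψ χ → ⊢ ((φ ⇝ (ψ ∧' χ)) ⇔ ((φ ⇝ ψ) ∧' (φ ⇝ χ)))
  A4   : ∀ φ ψ → ⊢ ((φ ⇝ ψ) ⇒ (φ ⇒ ψ))
  A5   : ∀ φ ψ → ⊢ ((φ ⇝ ψ) ⇔ ((¬' ψ) ⇝ (¬' φ)))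
  A8   : ∀ φ → ⊢ (([∀] φ) ⇒ ([∀] ([∀] φ)))
  A9   : ∀ φ → ⊢ ((¬' ([∀] φ)) ⇒ ([∀] (¬' ([∀] φ))))
  A10  : ∀ φ ψ → ⊢ ((φ ⇝ ψ) ⇔ ([∀] (φ ⇝ ψ)))
  A11  : ∀ φ → ⊢ (([∀] φ) ⇒ ((¬' ([∀] φ)) ⇝ ⊥'))
  K    : ∀ φ ψ → ⊢ ((□ (φ ⇒ ψ)) ⇒ ((□ φ) ⇒ (□ ψ)))
  Add  : ∀ φ ψ → ⊢ ((φ ⇝ ψ) ⇒ ((□ φ) ⇝ (□ ψ)))
  mp   : ∀ {φ ψ} → ⊢ (φ ⇒ ψ) → ⊢ φ → ⊢ ψ
  nec∀ : ∀ {φ} → ⊢ φ → ⊢ ([∀] φ)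
  nec□ : ∀ {φ} → ⊢ φ → ⊢ (□ φ)

data Occurs (p : ℕ) : Fm → Set where
  here  : Occurs p (var p)
  ¬o    : ∀ {φ} → Occurs p φ → Occurs p (¬' φ)
  ∧l    : ∀ {φ ψ} → Occurs p φ → Occurs p (φ ∧' ψ)
  ∧r    : ∀ {φ ψ} → Occurs p ψ → Occurs p (φ ∧' ψ)
  ∨l    : ∀ {φ ψ} → Occurs p φ → Occurs p (φ ∨' ψ)
  ∨r    : ∀ {φ ψ} → Occurs p ψ → Occurs p (φ ∨' ψ)
  ⇒l    : ∀ {φ ψ} → Occurs p φ → Occurs p (φ ⇒ ψ)
  ⇒r    : ∀ {φ ψ} → Occurs p ψ → Occurs p (φ ⇒ ψ)
  ⇔l    : ∀ {φ ψ} → Occurs p φ → Occurs p (φ ⇔ ψ)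
  ⇔r    : ∀ {φ ψ} → Occurs p ψ → Occurs p (φ ⇔ ψ)
  ⇝l    : ∀ {φ ψ} → Occurs p φ → Occurs p (φ ⇝ ψ)
  ⇝r    : ∀ {φ ψ} → Occurs p ψ → Occurs p (φ ⇝ ψ)
  □o    : ∀ {φ} → Occurs p φ → Occurs p (□ φ)

{-# OPTIONS --safe #-}
module Submission where

-- ⊢ does not visibly replace provable equivalents under ⇝, so no algebraic model extension is
-- attempted.  Instead a translation τ maps theorems to theorems, fixes every formula without p,
-- sends p to φ and commutes with the Boolean connectives and □.  A strict implication α ⇝ β in
-- which p occurs is taken apart as far as the axioms force it; what remains is read as
-- [∀] (τ α ⇒ τ β).  Thus τ (p ⇝ φ) is a theorem since τ p is φ, and τ turns
-- (p ⇝ φ) ∧ p → ψ into a formula from which φ → ψ follows.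

open import Defs
open import Data.Bool using (Bool; true; false; not; _∧_; _∨_; if_then_else_)
open import Data.Bool.Properties using (∧-conicalˡ; ∧-conicalʳ)
open import Data.Nat using (ℕ; _≟_)
open import Data.Product using (_×_; _,_; proj₁; proj₂; swap)
open import Function using (_∘_)
open import Relation.Binary.PropositionalEquality
  using (_≡_; refl; sym; trans; cong; cong₂; subst)
open import Relation.Nullary using (¬_; does)
open import Relation.Nullary.Decidable using (dec-true; dec-false)

private variable
  α β γ δ χ ξ : Fm

-- Propositional and modal reasoning in ⊢

⇒-const : ⊢ (α ⇒ β ⇒ α)
⇒-const {α} {β} = taut λ V → lemma (eval V α) (eval V β)
  where
  lemma : ∀ a b → not a ∨ (not b ∨ a) ≡ true
  lemma false _     = refl
  lemma true  false = refl
  lemma true  true  = refl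

⇒-distrib : ⊢ ((α ⇒ β ⇒ γ) ⇒ (α ⇒ β) ⇒ α ⇒ γ)
⇒-distrib {α} {β} {γ} = taut λ V → lemma (eval V α) (eval V β) (eval V γ)
  where
  lemma : ∀ a b c → not (not a ∨ (not b ∨ c)) ∨ (not (not a ∨ b) ∨ (not a ∨ c)) ≡ true
  lemma false _     _     = refl
  lemma true  false _     = refl
  lemma true  true  false = refl
  lemma true  true  true  = refl

∧-projˡ : ⊢ ((α ∧' β) ⇒ α)
∧-projˡ {α} {β} = taut λ V → lemma (eval V α) (eval V β)
  where
  lemma : ∀ a b → not (a ∧ b) ∨ a ≡ true
  lemma false _     = refl
  lemma true  false = refl
  lemma true  true  = refl

∧-projʳ : ⊢ ((α ∧' β) ⇒ β)
∧-projʳ {α} {β} = taut λ V → lemma (eval V α) (eval V β)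
  where
  lemma : ∀ a b → not (a ∧ b) ∨ b ≡ true
  lemma false _     = refl
  lemma true  false = refl
  lemma true  true  = refl

∧-pair : ⊢ (α ⇒ β ⇒ (α ∧' β))
∧-pair {α} {β} = taut λ V → lemma (eval V α) (eval V β)
  where
  lemma : ∀ a b → not a ∨ (not b ∨ (a ∧ b)) ≡ true
  lemma false _     = refl
  lemma true  false = refl
  lemma true  true  = refl

∨-copair : ⊢ ((α ⇒ γ) ⇒ (β ⇒ γ) ⇒ (α ∨' β) ⇒ γ)
∨-copair {α} {γ} {β} = taut λ V → lemma (eval V α) (eval V β) (eval V γ)
  where
  lemma : ∀ a b c → not (not a ∨ c) ∨ (not (not b ∨ c) ∨ (not (a ∨ b) ∨ c)) ≡ true
  lemma false false _     = refl
  lemma false true  false = refl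
  lemma false true  true  = refl
  lemma true  _     false = refl
  lemma true  false true  = refl
  lemma true  true  true  = refl

contraposition : ⊢ ((α ⇒ β) ⇒ (¬' β) ⇒ (¬' α))
contraposition {α} {β} = taut λ V → lemma (eval V α) (eval V β)
  where
  lemma : ∀ a b → not (not a ∨ b) ∨ (not (not b) ∨ not a) ≡ true
  lemma false false = refl
  lemma false true  = refl
  lemma true  false = refl
  lemma true  true  = refl

¬¬-elim : ⊢ ((¬' (¬' α)) ⇒ α)
¬¬-elim {α} = taut λ V → lemma (eval V α)
  where
  lemma : ∀ a → not (not (not a)) ∨ a ≡ true
  lemma false = refl
  lemma true  = refl

¬¬-intro : ⊢ (α ⇒ (¬' (¬' α)))
¬¬-intro {α} = taut λ V → lemma (eval V α)
  where
  lemma : ∀ a → not a ∨ not (not a) ≡ true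
  lemma false = refl
  lemma true  = refl

explosion : ⊢ (α ⇒ (¬' α) ⇒ β)
explosion {α} {β} = taut λ V → lemma (eval V α) (eval V β)
  where
  lemma : ∀ a b → not a ∨ (not (not a) ∨ b) ≡ true
  lemma false _ = refl
  lemma true  _ = refl

de-morgan : ⊢ ((¬' (α ∧' β)) ⇒ ((¬' α) ∨' (¬' β)))
de-morgan {α} {β} = taut λ V → lemma (eval V α) (eval V β)
  where
  lemma : ∀ a b → not (not (a ∧ b)) ∨ (not a ∨ not b) ≡ true
  lemma false _     = refl
  lemma true  false = refl
  lemma true  true  = refl

⇔-forward : ⊢ ((α ⇔ β) ⇒ α ⇒ β)
⇔-forward {α} {β} = taut λ V → lemma (eval V α) (eval V β)
  where
  lemma : ∀ a b → not (if a then b else not b) ∨ (not a ∨ b) ≡ true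
  lemma false false = refl
  lemma false true  = refl
  lemma true  false = refl
  lemma true  true  = refl

⇔-backward : ⊢ ((α ⇔ β) ⇒ β ⇒ α)
⇔-backward {α} {β} = taut λ V → lemma (eval V α) (eval V β)
  where
  lemma : ∀ a b → not (if a then b else not b) ∨ (not b ∨ a) ≡ true
  lemma false false = refl
  lemma false true  = refl
  lemma true  false = refl
  lemma true  true  = refl

⇔-pair : ⊢ ((α ⇒ β) ⇒ (β ⇒ α) ⇒ (α ⇔ β))
⇔-pair {α} {β} = taut λ V → lemma (eval V α) (eval V β)
  where
  lemma : ∀ a b →
    not (not a ∨ b) ∨ (not (not b ∨ a) ∨ (if a then b else not b)) ≡ true
  lemma false false = refl
  lemma false true  = refl
  lemma true  false = refl
  lemma true  true  = refl

⊢⊤ : ⊢ ⊤'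
⊢⊤ = taut λ _ → refl

⇒-weaken : ⊢ β → ⊢ (α ⇒ β)
⇒-weaken = mp ⇒-const

⇒-apply : ⊢ (α ⇒ β ⇒ γ) → ⊢ (α ⇒ β) → ⊢ (α ⇒ γ)
⇒-apply f x = mp (mp ⇒-distrib f) x

⇒-refl : ⊢ (α ⇒ α)
⇒-refl {α} = ⇒-apply ⇒-const (⇒-const {β = α})

⇒-trans : ⊢ (α ⇒ β) → ⊢ (β ⇒ γ) → ⊢ (α ⇒ γ)
⇒-trans f g = ⇒-apply (⇒-weaken g) f

∧-intro : ⊢ α → ⊢ β → ⊢ (α ∧' β)
∧-intro x y = mp (mp ∧-pair x) y

⟨_,_⟩ : ⊢ (γ ⇒ α) → ⊢ (γ ⇒ β) → ⊢ (γ ⇒ (α ∧' β))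
⟨ f , g ⟩ = ⇒-apply (⇒-trans f ∧-pair) g

∧-map : ⊢ (α ⇒ γ) → ⊢ (β ⇒ δ) → ⊢ ((α ∧' β) ⇒ (γ ∧' δ))
∧-map f g = ⟨ ⇒-trans ∧-projˡ f , ⇒-trans ∧-projʳ g ⟩

∧-interchange : ⊢ (((α ∧' β) ∧' (γ ∧' δ)) ⇒ ((α ∧' γ) ∧' (β ∧' δ)))
∧-interchange = ⟨ ∧-map ∧-projˡ ∧-projˡ , ∧-map ∧-projʳ ∧-projʳ ⟩

⇒-∧ : ⊢ (((χ ⇒ α) ∧' (χ ⇒ β)) ⇒ χ ⇒ (α ∧' β))
⇒-∧ = ⇒-apply
  (⇒-trans ∧-projˡ (⇒-trans (mp ⇒-distrib (⇒-weaken ∧-pair)) ⇒-distrib)) ∧-projʳ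

contrapose : ⊢ (α ⇒ β) → ⊢ ((¬' β) ⇒ (¬' α))
contrapose = mp contraposition

infix 4 _≈_
_≈_ : Fm → Fm → Set
α ≈ β = ⊢ (α ⇒ β) × ⊢ (β ⇒ α)

≈-refl : α ≈ α
≈-refl = ⇒-refl , ⇒-refl

≈-trans : α ≈ β → β ≈ γ → α ≈ γ
≈-trans (f , f′) (g , g′) = ⇒-trans f g , ⇒-trans g′ f′

∧-cong : α ≈ γ → β ≈ δ → (α ∧' β) ≈ (γ ∧' δ)
∧-cong (f , f′) (g , g′) = ∧-map f g , ∧-map f′ g′

⇔⇒≈ : ⊢ (α ⇔ β) → α ≈ β
⇔⇒≈ e = mp ⇔-forward e , mp ⇔-backward e

≈⇒⇔ : α ≈ β → ⊢ (α ⇔ β)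
≈⇒⇔ (f , g) = mp (mp ⇔-pair f) g

□-mono : ⊢ (α ⇒ β) → ⊢ ((□ α) ⇒ (□ β))
□-mono f = mp (K _ _) (nec□ f)

□-∧ : ⊢ (((□ α) ∧' (□ β)) ⇒ (□ (α ∧' β)))
□-∧ = ⇒-apply (⇒-trans ∧-projˡ (⇒-trans (□-mono ∧-pair) (K _ _))) ∧-projʳ

[∀]-elim : ⊢ (([∀] α) ⇒ α)
[∀]-elim = ⇒-apply (A4 _ _) (⇒-weaken ⊢⊤)

-- `Add` turns `⊤' ⇝ α` into `□ ⊤' ⇝ □ α`; by `A4` this is an implication, and its antecedent is a
-- theorem.
[∀]⇒□ : ⊢ (([∀] α) ⇒ (□ α))
[∀]⇒□ = ⇒-apply (⇒-trans (Add _ _) (A4 _ _)) (⇒-weaken (nec□ ⊢⊤))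

-- Rigid formulas: truth and falsity both pass under `□`

Rigid : Fm → Set
Rigid χ = ⊢ (χ ⇒ (□ χ)) × ⊢ ((¬' χ) ⇒ (□ (¬' χ)))

-- `A10` makes `α ⇝ β` equivalent to a `[∀]`-formula, so `A9` puts its negation under `[∀]` too, and
-- `[∀]⇒□` does the rest.
rigid-⇝ : ∀ α β → Rigid (α ⇝ β)
rigid-⇝ α β =
    ⇒-trans (proj₁ e) [∀]⇒□
  , ⇒-trans (contrapose (proj₂ e))
      (⇒-trans (A9 _) (⇒-trans [∀]⇒□ (□-mono (contrapose (proj₁ e)))))
  where
  e : (α ⇝ β) ≈ ([∀] (α ⇝ β))
  e = ⇔⇒≈ (A10 α β)

-- The two halves trade places. `Rigid` carries the negative half because `univ¬` negates a
-- translated strict implication.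
rigid-¬ : Rigid χ → Rigid (¬' χ)
rigid-¬ (f , g) = g , ⇒-trans ¬¬-elim (⇒-trans f (□-mono ¬¬-intro))

rigid-∧ : Rigid χ → Rigid ξ → Rigid (χ ∧' ξ)
rigid-∧ (f , f′) (g , g′) =
    ⇒-trans (∧-map f g) □-∧
  , ⇒-trans de-morgan
      (mp (mp ∨-copair (⇒-trans f′ (□-mono (contrapose ∧-projˡ))))
          (⇒-trans g′ (□-mono (contrapose ∧-projʳ))))

-- One constructor for each way an axiom ties α ⇝ β to other formulas: A2, A3, A5, Add, A10 (and
-- A8), A9, A11, in this order.
data Shape : Fm → Fm → Set where
  disj   : ∀ {α β γ} → Shape (α ∨' β) γ
  conj   : ∀ {α β γ} → Shape α (β ∧' γ)
  neg    : ∀ {α β} → Shape (¬' α) (¬' β)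
  box    : ∀ {α β} → Shape (□ α) (□ β)
  univ   : ∀ {α β} → Shape ⊤' (α ⇝ β)
  univ¬  : ∀ {α β} → Shape ⊤' (¬' (α ⇝ β))
  absurd : ∀ {α β} → Shape (¬' (α ⇝ β)) ⊥'
  other  : ∀ {α β} → Shape α β

-- Clauses are tried in order; a disjunction against a conjunction is disj, and A3 is then
-- recovered in τ⇝-∧ below.
shape : ∀ α β → Shape α β
shape (_ ∨' _)      _             = disj
shape _             (_ ∧' _)      = conj
shape (¬' _)        (¬' _)        = neg
shape (□ _)         (□ _)         = box
shape ⊤'            (_ ⇝ _)       = univ
shape ⊤'            (¬' (_ ⇝ _))  = univ¬
shape (¬' (_ ⇝ _))  ⊥'            = absurd
shape _             _             = other

-- The translation `τ`

module Translation (p : ℕ) (φ : Fm) where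

  fresh : Fm → Bool
  fresh (var q)  = not (does (q ≟ p))
  fresh ⊤'       = true
  fresh ⊥'       = true
  fresh (¬' α)   = fresh α
  fresh (α ∧' β) = fresh α ∧ fresh β
  fresh (α ∨' β) = fresh α ∧ fresh β
  fresh (α ⇒ β)  = fresh α ∧ fresh β
  fresh (α ⇔ β)  = fresh α ∧ fresh β
  fresh (α ⇝ β)  = fresh α ∧ fresh β
  fresh (□ α)    = fresh α

  ¬Occurs⇒fresh : ∀ α → ¬ Occurs p α → fresh α ≡ true
  ¬Occurs⇒fresh (var q)  n = cong not (dec-false (q ≟ p) λ { refl → n here })
  ¬Occurs⇒fresh ⊤'       n = refl
  ¬Occurs⇒fresh ⊥'       n = refl
  ¬Occurs⇒fresh (¬' α)   n = ¬Occurs⇒fresh α (n ∘ ¬o)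
  ¬Occurs⇒fresh (α ∧' β) n = cong₂ _∧_ (¬Occurs⇒fresh α (n ∘ ∧l)) (¬Occurs⇒fresh β (n ∘ ∧r))
  ¬Occurs⇒fresh (α ∨' β) n = cong₂ _∧_ (¬Occurs⇒fresh α (n ∘ ∨l)) (¬Occurs⇒fresh β (n ∘ ∨r))
  ¬Occurs⇒fresh (α ⇒ β)  n = cong₂ _∧_ (¬Occurs⇒fresh α (n ∘ ⇒l)) (¬Occurs⇒fresh β (n ∘ ⇒r))
  ¬Occurs⇒fresh (α ⇔ β)  n = cong₂ _∧_ (¬Occurs⇒fresh α (n ∘ ⇔l)) (¬Occurs⇒fresh β (n ∘ ⇔r))
  ¬Occurs⇒fresh (α ⇝ β)  n = cong₂ _∧_ (¬Occurs⇒fresh α (n ∘ ⇝l)) (¬Occurs⇒fresh β (n ∘ ⇝r))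
  ¬Occurs⇒fresh (□ α)    n = ¬Occurs⇒fresh α (n ∘ □o)

  mutual
    τ : Fm → Fm
    τ (var q)  = if does (q ≟ p) then φ else var q
    τ ⊤'       = ⊤'
    τ ⊥'       = ⊥'
    τ (¬' α)   = ¬' (τ α)
    τ (α ∧' β) = τ α ∧' τ β
    τ (α ∨' β) = τ α ∨' τ β
    τ (α ⇒ β)  = τ α ⇒ τ β
    τ (α ⇔ β)  = τ α ⇔ τ β
    τ (α ⇝ β)  = τ⇝ α β
    τ (□ α)    = □ (τ α)

    -- Freshness is tested before the shape, so a strict implication without `p` stays intact even
    -- where `reduce` would alter it.
    τ⇝ : Fm → Fm → Fm
    τ⇝ α β = if fresh α ∧ fresh β then α ⇝ β else reduce (shape α β)

    -- Except for `other`, each value is the translation of the opposite side of the axiom behind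
    -- the shape. One-way axioms such as `Add` are thus read as equivalences.
    reduce : ∀ {α β} → Shape α β → Fm
    reduce (disj {α} {β} {γ})  = τ⇝ α γ ∧' τ⇝ β γ
    reduce (conj {α} {β} {γ})  = τ⇝ α β ∧' τ⇝ α γ
    reduce (neg {α} {β})       = τ⇝ β α
    reduce (box {α} {β})       = τ⇝ α β
    reduce (univ {α} {β})      = τ⇝ α β
    reduce (univ¬ {α} {β})     = ¬' (τ⇝ α β)
    reduce (absurd {α} {β})    = τ⇝ α β
    reduce (other {α} {β})     = [∀] (τ α ⇒ τ β)

  τ-fresh : ∀ α → fresh α ≡ true → τ α ≡ α
  τ-fresh₂ : ∀ (_∙_ : Fm → Fm → Fm) α β → fresh α ∧ fresh β ≡ true →
             τ α ∙ τ β ≡ α ∙ β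
  τ-fresh (var q) f with does (q ≟ p)
  ... | false = refl
  τ-fresh ⊤'       f = refl
  τ-fresh ⊥'       f = refl
  τ-fresh (¬' α)   f = cong ¬'_ (τ-fresh α f)
  τ-fresh (α ∧' β) f = τ-fresh₂ _∧'_ α β f
  τ-fresh (α ∨' β) f = τ-fresh₂ _∨'_ α β f
  τ-fresh (α ⇒ β)  f = τ-fresh₂ _⇒_ α β f
  τ-fresh (α ⇔ β)  f = τ-fresh₂ _⇔_ α β f
  τ-fresh (α ⇝ β)  f rewrite f = refl
  τ-fresh (□ α)    f = cong □_ (τ-fresh α f)
  τ-fresh₂ _∙_ α β f =
    cong₂ _∙_ (τ-fresh α (∧-conicalˡ _ _ f)) (τ-fresh β (∧-conicalʳ _ _ f))

  -- As `τ` commutes with the Boolean connectives, it acts only on the atoms of `eval`; hence it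
  -- maps tautologies to tautologies.
  eval-τ : ∀ V α → eval V (τ α) ≡ eval (eval V ∘ τ) α
  eval-τ V (var _)  = refl
  eval-τ V ⊤'       = refl
  eval-τ V ⊥'       = refl
  eval-τ V (¬' α)   = cong not (eval-τ V α)
  eval-τ V (α ∧' β) = cong₂ _∧_ (eval-τ V α) (eval-τ V β)
  eval-τ V (α ∨' β) = cong₂ _∨_ (eval-τ V α) (eval-τ V β)
  eval-τ V (α ⇒ β)  = cong₂ (λ a b → not a ∨ b) (eval-τ V α) (eval-τ V β)
  eval-τ V (α ⇔ β)  = cong₂ (λ a b → if a then b else not b) (eval-τ V α) (eval-τ V β)
  eval-τ V (_ ⇝ _)  = refl
  eval-τ V (□ _)    = refl

  -- Unfolding ends in strict implications joined by conjunction and negation, all of which preserve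
  -- rigidity. The `box` case of `reduce-elim` relies on this.
  rigid-τ⇝ : ∀ α β → Rigid (τ⇝ α β)
  rigid-reduce : ∀ {α β} (s : Shape α β) → Rigid (reduce s)
  rigid-τ⇝ α β with fresh α ∧ fresh β
  ... | true  = rigid-⇝ α β
  ... | false = rigid-reduce (shape α β)
  rigid-reduce (disj {α} {β} {γ})  = rigid-∧ (rigid-τ⇝ α γ) (rigid-τ⇝ β γ)
  rigid-reduce (conj {α} {β} {γ})  = rigid-∧ (rigid-τ⇝ α β) (rigid-τ⇝ α γ)
  rigid-reduce (neg {α} {β})       = rigid-τ⇝ β α
  rigid-reduce (box {α} {β})       = rigid-τ⇝ α β
  rigid-reduce (univ {α} {β})      = rigid-τ⇝ α β
  rigid-reduce (univ¬ {α} {β})     = rigid-¬ (rigid-τ⇝ α β)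
  rigid-reduce (absurd {α} {β})    = rigid-τ⇝ α β
  rigid-reduce other               = rigid-⇝ _ _

  -- This is the translation of `A4`, the constraint that keeps the choices in `reduce` from being
  -- too weak.
  τ⇝-elim : ∀ α β → ⊢ (τ⇝ α β ⇒ τ α ⇒ τ β)
  reduce-elim : ∀ {α β} (s : Shape α β) → ⊢ (reduce s ⇒ τ α ⇒ τ β)
  τ⇝-elim α β with fresh α ∧ fresh β in f
  ... | true  = subst (λ θ → ⊢ ((α ⇝ β) ⇒ θ)) (sym (τ-fresh₂ _⇒_ α β f)) (A4 α β)
  ... | false = reduce-elim (shape α β)
  reduce-elim (disj {α} {β} {γ}) =
    ⇒-apply (⇒-trans (⇒-trans ∧-projˡ (τ⇝-elim α γ)) ∨-copair)
            (⇒-trans ∧-projʳ (τ⇝-elim β γ))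
  reduce-elim (conj {α} {β} {γ}) = ⇒-trans (∧-map (τ⇝-elim α β) (τ⇝-elim α γ)) ⇒-∧
  reduce-elim (neg {α} {β}) = ⇒-trans (τ⇝-elim β α) contraposition
  -- Add only preserves the underlying strict implication; rigidity moves it under □.
  reduce-elim (box {α} {β}) =
    ⇒-trans (proj₁ (rigid-τ⇝ α β)) (⇒-trans (□-mono (τ⇝-elim α β)) (K _ _))
  reduce-elim univ   = ⇒-const
  reduce-elim univ¬  = ⇒-const
  reduce-elim absurd = explosion
  reduce-elim other  = [∀]-elim

  -- The shape is always `disj`, so both sides are the same formula unless all three parts are
  -- fresh, where `A2` applies.
  τ⇝-∨ : ∀ α β γ → τ⇝ (α ∨' β) γ ≈ (τ⇝ α γ ∧' τ⇝ β γ)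
  τ⇝-∨ α β γ with fresh α | fresh β | fresh γ
  ... | true  | true  | true  = ⇔⇒≈ (A2 α β γ)
  ... | true  | true  | false = ≈-refl
  ... | true  | false | _     = ≈-refl
  ... | false | _     | _     = ≈-refl

  τ⇝-∧ : ∀ α β γ → τ⇝ α (β ∧' γ) ≈ (τ⇝ α β ∧' τ⇝ α γ)
  τ⇝-∧ α β γ = go α
    where
    -- `shape` is stuck until the head of `α` is known, so its value enters as an equation that `go`
    -- settles head by head.
    by-shape : ∀ α → shape α (β ∧' γ) ≡ conj → τ⇝ α (β ∧' γ) ≈ (τ⇝ α β ∧' τ⇝ α γ)
    by-shape α eq rewrite eq with fresh α | fresh β | fresh γ
    ... | true  | true  | true  = ⇔⇒≈ (A3 α β γ)
    ... | true  | true  | false = ≈-refl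
    ... | true  | false | _     = ≈-refl
    ... | false | _     | _     = ≈-refl
    go : ∀ α → τ⇝ α (β ∧' γ) ≈ (τ⇝ α β ∧' τ⇝ α γ)
    -- Here `disj` takes precedence: split the disjunction, treat each disjunct by induction,
    -- regroup the four conjuncts and reassemble.
    go (α₁ ∨' α₂) =
      ≈-trans (τ⇝-∨ α₁ α₂ (β ∧' γ))
        (≈-trans (∧-cong (go α₁) (go α₂))
          (≈-trans (∧-interchange , ∧-interchange)
            (swap (∧-cong (τ⇝-∨ α₁ α₂ β) (τ⇝-∨ α₁ α₂ γ)))))
    go α@(var _)  = by-shape α refl
    go α@⊤'       = by-shape α refl
    go α@⊥'       = by-shape α refl
    go α@(¬' _)   = by-shape α refl
    go α@(_ ∧' _) = by-shape α refl
    go α@(_ ⇒ _)  = by-shape α refl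
    go α@(_ ⇔ _)  = by-shape α refl
    go α@(_ ⇝ _)  = by-shape α refl
    go α@(□ _)    = by-shape α refl

  -- With `⊥'` on the left only `conj` and `other` can arise, so the induction runs along the
  -- conjuncts of `β`.
  τ⇝-⊥ˡ : ∀ β → ⊢ τ⇝ ⊥' β
  τ⇝-⊥ˡ β with fresh β | shape ⊥' β
  ... | true  | _ = mp ∧-projˡ (A1 β)
  ... | false | conj {β = β₁} {β₂} = ∧-intro (τ⇝-⊥ˡ β₁) (τ⇝-⊥ˡ β₂)
  ... | false | other = nec∀ (taut λ _ → refl)

  τ⇝-⊤ʳ : ∀ α → ⊢ τ⇝ α ⊤'
  τ⇝-⊤ʳ α with fresh α | shape α ⊤'
  ... | true  | _ = mp ∧-projʳ (A1 α)
  ... | false | disj {α₁} {α₂} = ∧-intro (τ⇝-⊤ʳ α₁) (τ⇝-⊤ʳ α₂)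
  ... | false | other = nec∀ (⇒-weaken ⊢⊤)

  -- For `univ` and `univ¬` the reduced formula is `τ β` itself; conjunctions are split, and `other`
  -- is plain necessitation.
  τ-nec∀ : ∀ β → ⊢ τ β → ⊢ τ⇝ ⊤' β
  τ-nec∀ β d with fresh β in f | shape ⊤' β
  ... | true  | _ = nec∀ (subst ⊢_ (τ-fresh β f) d)
  ... | false | conj {β = β₁} {β₂} =
    ∧-intro (τ-nec∀ β₁ (mp ∧-projˡ d)) (τ-nec∀ β₂ (mp ∧-projʳ d))
  ... | false | univ  = d
  ... | false | univ¬ = d
  ... | false | other = nec∀ (⇒-weaken d)

  -- Soundness of the translation

  sound : ∀ {θ} → ⊢ θ → ⊢ τ θ
  sound (taut {θ} t) = taut λ V → trans (eval-τ V θ) (t (eval V ∘ τ))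
  sound (A1 α)     = ∧-intro (τ⇝-⊥ˡ α) (τ⇝-⊤ʳ α)
  sound (A2 α β γ) = ≈⇒⇔ (τ⇝-∨ α β γ)
  sound (A3 α β γ) = ≈⇒⇔ (τ⇝-∧ α β γ)
  sound (A4 α β)   = τ⇝-elim α β
  -- The contraposed side tests `fresh β ∧ fresh α`, in swapped order, so the two values are
  -- abstracted separately.
  sound (A5 α β) with fresh α | fresh β
  ... | true  | true  = A5 α β
  ... | true  | false = ≈⇒⇔ ≈-refl
  ... | false | true  = ≈⇒⇔ ≈-refl
  ... | false | false = ≈⇒⇔ ≈-refl
  -- If `p` occurs, the outer `⇝` has shape `univ`, and its reduct is the antecedent. `A9`, `A10`,
  -- `A11` and `Add` collapse likewise through their own shapes.
  sound (A8 α) with fresh α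
  ... | true  = A8 α
  ... | false = ⇒-refl
  sound (A9 α) with fresh α
  ... | true  = A9 α
  ... | false = ⇒-refl
  sound (A10 α β) with fresh α ∧ fresh β
  ... | true  = A10 α β
  ... | false = ≈⇒⇔ ≈-refl
  sound (A11 α) with fresh α
  ... | true  = A11 α
  ... | false = ⇒-refl
  sound (K α β)    = K (τ α) (τ β)
  sound (Add α β) with fresh α ∧ fresh β
  ... | true  = Add α β
  ... | false = ⇒-refl
  sound (mp d e)     = mp (sound d) (sound e)
  sound (nec∀ {α} d) = τ-nec∀ α (sound d)
  sound (nec□ d)     = nec□ (sound d)

  -- Translating `p` and deriving the rule

  does-p≟p : does (p ≟ p) ≡ true
  does-p≟p = dec-true (p ≟ p) refl

  τ-var : τ (var p) ≡ φ
  τ-var = cong (if_then φ else var p) does-p≟p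

  -- A variable on the left leaves only `conj` and `other`. The right side is a general `β` so that
  -- the induction can descend into conjuncts while `φ` stays fixed.
  τ⇝-var : ∀ β → ⊢ (φ ⇒ τ β) → ⊢ τ⇝ (var p) β
  -- This rewrite makes `fresh (var p)` false; the one under `other` turns `τ (var p)` into `φ`.
  τ⇝-var β d rewrite does-p≟p with shape (var p) β
  ... | conj {β = β₁} {β₂} =
    ∧-intro (τ⇝-var β₁ (⇒-trans d ∧-projˡ)) (τ⇝-var β₂ (⇒-trans d ∧-projʳ))
  ... | other rewrite does-p≟p = nec∀ d

theorem4p12 : (p : ℕ) (φ ψ : Fm) → ¬ Occurs p φ → ¬ Occurs p ψ →
    ⊢ (((var p ⇝ φ) ∧' var p) ⇒ ψ) → ⊢ (φ ⇒ ψ)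
theorem4p12 p φ ψ p∉φ p∉ψ d = ⇒-trans ⟨ ⇒-weaken p⇝φ , φ⇒p ⟩ τd
  where
  open Translation p φ
  φ⇒τφ : ⊢ (φ ⇒ τ φ)
  φ⇒τφ = subst (λ θ → ⊢ (φ ⇒ θ)) (sym (τ-fresh φ (¬Occurs⇒fresh φ p∉φ))) ⇒-refl
  p⇝φ : ⊢ τ⇝ (var p) φ
  p⇝φ = τ⇝-var φ φ⇒τφ
  φ⇒p : ⊢ (φ ⇒ τ (var p))
  φ⇒p = subst (λ θ → ⊢ (φ ⇒ θ)) (sym τ-var) ⇒-refl
  τd : ⊢ ((τ⇝ (var p) φ ∧' τ (var p)) ⇒ ψ)
  τd = subst (λ θ → ⊢ ((τ⇝ (var p) φ ∧' τ (var p)) ⇒ θ))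
             (τ-fresh ψ (¬Occurs⇒fresh ψ p∉ψ)) (sound d)
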